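{- Let $\mathbf{f}\colon\mathbb{R}^n\to\mathbb{R}^n$ be a polynomial vector field, $\mathcal{X}_0=\{\mathbf{x}\mid \mathcal{I}(\mathbf{x})\le 0\}$ and $\mathcal{X}_u=\{\mathbf{x}\mid\mathcal{U}(\mathbf{x})\le 0\}$ with $\mathcal{I},\mathcal{U}\in\mathbb{R}[\mathbf{x}]$, and let $B\in\mathbb{R}[\mathbf{x}]$. Suppose there exist $\epsilon>0$, polynomials $v_{i,j}\in\mathbb{R}[\mathbf{x}]$ ($1\le i\le N_{B,\mathbf{f}}$, $0\le j\le i-1$) and sum-of-squares polynomials $\sigma,\sigma'$ such that (1) $-B(\mathbf{x})+\sigma(\mathbf{x})\mathcal{I}(\mathbf{x})$ is SOS; (2) for all $1\le i\le N_{B,\mathbf{f}}$, $-\mathcal{L}^i_{\mathbf{f}}B(\mathbf{x})+\sum_{j=0}^{i-1}v_{i,j}(\mathbf{x})\mathcal{L}^j_{\mathbf{f}}B(\mathbf{x})$ is SOS; (3) $B(\mathbf{x})+\sigma'(\mathbf{x})\mathcal{U}(\mathbf{x})-\epsilon$ is SOS. Then $B$ is an invariant barrier certificate of $\dot{\mathbf{x}}=\mathbf{f}(\mathbf{x})$ with respect to $\mathcal{X}_0$ and $\mathcal{X}_u$.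
   Context: A polynomial is SOS (sum of squares) if it equals $\sum_k g_k^2$ for some polynomials $g_k$. The Lie derivatives of $B$ along $\mathbf{f}$ are $\mathcal{L}^0_{\mathbf{f}}B=B$ and $\mathcal{L}^k_{\mathbf{f}}B=\langle \nabla \mathcal{L}^{k-1}_{\mathbf{f}}B,\mathbf{f}\rangle$ for $k>0$. $N_{B,\mathbf{f}}\in\mathbb{N}^+$ denotes the completeness threshold: the minimal index $i$ such that $\mathcal{L}^{i+1}_{\mathbf{f}}B$ belongs to the polynomial ideal generated by $\mathcal{L}^0_{\mathbf{f}}B,\dots,\mathcal{L}^i_{\mathbf{f}}B$. A polynomial $B$ is an invariant barrier certificate (w.r.t. $\mathcal{X}_0,\mathcal{X}_u$) iff (initial) $B(\mathbf{x})\le 0$ for all $\mathbf{x}\in\mathcal{X}_0$; (consecution) for all $\mathbf{x}\in\mathbb{R}^n$ and all $1\le i\le N_{B,\mathbf{f}}$: if $\mathcal{L}^j_{\mathbf{f}}B(\mathbf{x})=0$ for all $0\le j\le i-1$, then $\mathcal{L}^i_{\mathbf{f}}B(\mathbf{x})\le 0$; (separation) $B(\mathbf{x})>0$ for all $\mathbf{x}\in\mathcal{X}_u$. -}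

module Defs where

open import Algebra.Bundles using (RawRing)
import Algebra.Definitions.RawSemiring as SemiringDefinitions
open import Data.Fin.Base using (Fin; toℕ)
open import Data.List.Base using (List; []; _∷_; _++_; map; cartesianProductWith)
import Data.List.Base as List
open import Data.Nat.Base as ℕ using (ℕ; zero; suc)
import Data.Nat.Properties as ℕ
open import Data.Product.Base using (Σ; ∃; _×_; _,_; proj₁; map₁)
open import Data.Rational.Base as ℚ using (ℚ; 0ℚ; 1ℚ; ½; Positive)
import Data.Rational.Properties as ℚ
open import Data.Rational.Solver using (module +-*-Solver)
open import Data.Vec.Base as Vec using (Vec; lookup; replicate; zipWith; _[_]%=_)
open import Data.Vec.Functional using (Vector)
import Data.Vec.Properties as Vec
open import Level using (0ℓ)
open import Relation.Binary.PropositionalEquality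
  using (_≡_; refl; sym; trans; cong; subst)
open import Relation.Nullary.Decidable.Core using (yes; no)
open import Relation.Unary using (Pred)

-- Real numbers: Cauchy sequences of rationals, equality being the
-- setoid relation _≈_ (the difference tends to 0).

Eventually : Pred ℕ 0ℓ → Set
Eventually P = ∃ λ N → ∀ n → N ℕ.≤ n → P n

IsCauchy : (ℕ → ℚ) → Set
IsCauchy x = ∀ ε → 0ℚ ℚ.< ε →
  ∃ λ N → ∀ m n → N ℕ.≤ m → N ℕ.≤ n → ℚ.∣ x m ℚ.- x n ∣ ℚ.≤ ε

record ℝ : Set where
  constructor mkℝ
  field
    seq    : ℕ → ℚ
    cauchy : IsCauchy seq

open ℝ public

infix 4 _≈_ _≤_ _<_

_≈_ : ℝ → ℝ → Set
x ≈ y = ∀ ε → 0ℚ ℚ.< ε → Eventually λ n → ℚ.∣ seq x n ℚ.- seq y n ∣ ℚ.≤ ε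

_≤_ : ℝ → ℝ → Set
x ≤ y = ∀ ε → 0ℚ ℚ.< ε → Eventually λ n → seq x n ℚ.≤ seq y n ℚ.+ ε

_<_ : ℝ → ℝ → Set
x < y = ∃ λ ε → 0ℚ ℚ.< ε × Eventually λ n → seq x n ℚ.+ ε ℚ.≤ seq y n

opaque
  ½-pos : ∀ ε → 0ℚ ℚ.< ε → 0ℚ ℚ.< ½ ℚ.* ε
  ½-pos ε ε>0 = ℚ.positive⁻¹ (½ ℚ.* ε) {{ℚ.pos*pos⇒pos ½ ε {{ℚ.positive ε>0}}}}

  ½+½ : ∀ ε → ½ ℚ.* ε ℚ.+ ½ ℚ.* ε ≡ ε
  ½+½ ε = trans (sym (ℚ.*-distribʳ-+ ε ½ ½)) (ℚ.*-identityˡ ε)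

  +-split : ∀ a b c d → (a ℚ.+ b) ℚ.- (c ℚ.+ d) ≡ (a ℚ.- c) ℚ.+ (b ℚ.- d)
  +-split = solve 4 (λ a b c d →
    (a :+ b) :- (c :+ d) := (a :- c) :+ (b :- d)) refl
    where open +-*-Solver

  *-split : ∀ a b c d → (a ℚ.* b) ℚ.- (c ℚ.* d) ≡ a ℚ.* (b ℚ.- d) ℚ.+ d ℚ.* (a ℚ.- c)
  *-split = solve 4 (λ a b c d →
    (a :* b) :- (c :* d) := a :* (b :- d) :+ d :* (a :- c)) refl
    where open +-*-Solver

  neg-split : ∀ a b → (ℚ.- a) ℚ.- (ℚ.- b) ≡ ℚ.- (a ℚ.- b)
  neg-split = solve 2 (λ a b → (:- a) :- (:- b) := :- (a :- b)) refl
    where open +-*-Solver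

  m≡n+[m-n] : ∀ a b → a ≡ b ℚ.+ (a ℚ.- b)
  m≡n+[m-n] = solve 2 (λ a b → a := b :+ (a :- b)) refl
    where open +-*-Solver

  +-close : ∀ a b c d ε →
    ℚ.∣ a ℚ.- c ∣ ℚ.≤ ½ ℚ.* ε → ℚ.∣ b ℚ.- d ∣ ℚ.≤ ½ ℚ.* ε →
    ℚ.∣ (a ℚ.+ b) ℚ.- (c ℚ.+ d) ∣ ℚ.≤ ε
  +-close a b c d ε a~c b~d = begin
    ℚ.∣ (a ℚ.+ b) ℚ.- (c ℚ.+ d) ∣        ≡⟨ cong ℚ.∣_∣ (+-split a b c d) ⟩
    ℚ.∣ (a ℚ.- c) ℚ.+ (b ℚ.- d) ∣        ≤⟨ ℚ.∣p+q∣≤∣p∣+∣q∣ (a ℚ.- c) (b ℚ.- d) ⟩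
    ℚ.∣ a ℚ.- c ∣ ℚ.+ ℚ.∣ b ℚ.- d ∣      ≤⟨ ℚ.+-mono-≤ a~c b~d ⟩
    ½ ℚ.* ε ℚ.+ ½ ℚ.* ε                  ≡⟨ ½+½ ε ⟩
    ε                                    ∎
    where open ℚ.≤-Reasoning

  *-close : ∀ a b c d ε →
    ℚ.∣ a ℚ.* (b ℚ.- d) ∣ ℚ.≤ ½ ℚ.* ε → ℚ.∣ d ℚ.* (a ℚ.- c) ∣ ℚ.≤ ½ ℚ.* ε →
    ℚ.∣ a ℚ.* b ℚ.- c ℚ.* d ∣ ℚ.≤ ε
  *-close a b c d ε b~d a~c = begin
    ℚ.∣ a ℚ.* b ℚ.- c ℚ.* d ∣                          ≡⟨ cong ℚ.∣_∣ (*-split a b c d) ⟩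
    ℚ.∣ a ℚ.* (b ℚ.- d) ℚ.+ d ℚ.* (a ℚ.- c) ∣          ≤⟨ ℚ.∣p+q∣≤∣p∣+∣q∣ (a ℚ.* (b ℚ.- d)) (d ℚ.* (a ℚ.- c)) ⟩
    ℚ.∣ a ℚ.* (b ℚ.- d) ∣ ℚ.+ ℚ.∣ d ℚ.* (a ℚ.- c) ∣    ≤⟨ ℚ.+-mono-≤ b~d a~c ⟩
    ½ ℚ.* ε ℚ.+ ½ ℚ.* ε                                ≡⟨ ½+½ ε ⟩
    ε                                                  ∎
    where open ℚ.≤-Reasoning

  eventuallyBounded : ∀ x → IsCauchy x →
    ∃ λ K → 0ℚ ℚ.< K × Eventually λ n → ℚ.∣ x n ∣ ℚ.≤ K
  eventuallyBounded x cx with cx 1ℚ (ℚ.positive⁻¹ 1ℚ)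
  ... | N , close = K , K>0 , N , λ n N≤n → begin
      ℚ.∣ x n ∣                          ≡⟨ cong ℚ.∣_∣ (m≡n+[m-n] (x n) (x N)) ⟩
      ℚ.∣ x N ℚ.+ (x n ℚ.- x N) ∣        ≤⟨ ℚ.∣p+q∣≤∣p∣+∣q∣ (x N) (x n ℚ.- x N) ⟩
      ℚ.∣ x N ∣ ℚ.+ ℚ.∣ x n ℚ.- x N ∣    ≤⟨ ℚ.+-monoʳ-≤ ℚ.∣ x N ∣ (close n N N≤n ℕ.≤-refl) ⟩
      K                                  ∎
    where
    open ℚ.≤-Reasoning
    K : ℚ
    K = ℚ.∣ x N ∣ ℚ.+ 1ℚ
    K>0 : 0ℚ ℚ.< K
    K>0 = ℚ.+-mono-≤-< (ℚ.0≤∣p∣ (x N)) (ℚ.positive⁻¹ 1ℚ)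

  scale : ∀ K ε → 0ℚ ℚ.< K → 0ℚ ℚ.< ε →
    ∃ λ δ → 0ℚ ℚ.< δ × (∀ p q → ℚ.∣ p ∣ ℚ.≤ K → ℚ.∣ q ∣ ℚ.≤ δ → ℚ.∣ p ℚ.* q ∣ ℚ.≤ ε)
  scale K ε K>0 ε>0 = δ , ℚ.positive⁻¹ δ , bound
    where
    instance
      K-pos : Positive K
      K-pos = ℚ.positive K>0
      ε-pos : Positive ε
      ε-pos = ℚ.positive ε>0
      K-nonZero : ℚ.NonZero K
      K-nonZero = ℚ.pos⇒nonZero K
      1/K-pos : Positive (ℚ.1/ K)
      1/K-pos = ℚ.1/pos⇒pos K
    δ : ℚ
    δ = ℚ.1/ K ℚ.* ε
    instance
      δ-pos : Positive δ
      δ-pos = ℚ.pos*pos⇒pos (ℚ.1/ K) ε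
    open ℚ.≤-Reasoning
    bound : ∀ p q → ℚ.∣ p ∣ ℚ.≤ K → ℚ.∣ q ∣ ℚ.≤ δ → ℚ.∣ p ℚ.* q ∣ ℚ.≤ ε
    bound p q p≤K q≤δ = begin
      ℚ.∣ p ℚ.* q ∣            ≡⟨ ℚ.∣p*q∣≡∣p∣*∣q∣ p q ⟩
      ℚ.∣ p ∣ ℚ.* ℚ.∣ q ∣      ≤⟨ ℚ.*-monoʳ-≤-nonNeg ℚ.∣ q ∣ {{ℚ.nonNegative (ℚ.0≤∣p∣ q)}} p≤K ⟩
      K ℚ.* ℚ.∣ q ∣            ≤⟨ ℚ.*-monoˡ-≤-nonNeg K {{ℚ.pos⇒nonNeg K}} q≤δ ⟩
      K ℚ.* (ℚ.1/ K ℚ.* ε)     ≡⟨ ℚ.*-assoc K (ℚ.1/ K) ε ⟨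
      K ℚ.* ℚ.1/ K ℚ.* ε       ≡⟨ cong (ℚ._* ε) (ℚ.*-inverseʳ K) ⟩
      1ℚ ℚ.* ε                 ≡⟨ ℚ.*-identityˡ ε ⟩
      ε                        ∎

  const-cauchy : ∀ q → IsCauchy (λ _ → q)
  const-cauchy q ε ε>0 = 0 , λ _ _ _ _ →
    subst (ℚ._≤ ε) (sym (cong ℚ.∣_∣ (ℚ.+-inverseʳ q))) (ℚ.<⇒≤ ε>0)

  neg-cauchy : ∀ x → IsCauchy x → IsCauchy (λ n → ℚ.- x n)
  neg-cauchy x cx ε ε>0 with cx ε ε>0
  ... | N , close = N , λ m n N≤m N≤n →
    subst (ℚ._≤ ε)
      (sym (trans (cong ℚ.∣_∣ (neg-split (x m) (x n))) (ℚ.∣-p∣≡∣p∣ (x m ℚ.- x n))))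
      (close m n N≤m N≤n)

  +-cauchy : ∀ x y → IsCauchy x → IsCauchy y → IsCauchy (λ n → x n ℚ.+ y n)
  +-cauchy x y cx cy ε ε>0 =
    let M , closeˣ = cx (½ ℚ.* ε) (½-pos ε ε>0)
        N , closeʸ = cy (½ ℚ.* ε) (½-pos ε ε>0)
    in M ℕ.⊔ N , λ m n ≤m ≤n → +-close (x m) (y m) (x n) (y n) ε
         (closeˣ m n (ℕ.m⊔n≤o⇒m≤o M N ≤m) (ℕ.m⊔n≤o⇒m≤o M N ≤n))
         (closeʸ m n (ℕ.m⊔n≤o⇒n≤o M N ≤m) (ℕ.m⊔n≤o⇒n≤o M N ≤n))

  *-cauchy : ∀ x y → IsCauchy x → IsCauchy y → IsCauchy (λ n → x n ℚ.* y n)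
  *-cauchy x y cx cy ε ε>0 =
    let K , K>0 , P , boundˣ  = eventuallyBounded x cx
        L , L>0 , Q , boundʸ  = eventuallyBounded y cy
        δ  , δ>0  , smallʸ    = scale K (½ ℚ.* ε) K>0 (½-pos ε ε>0)
        δ′ , δ′>0 , smallˣ    = scale L (½ ℚ.* ε) L>0 (½-pos ε ε>0)
        M , closeˣ            = cx δ′ δ′>0
        N , closeʸ            = cy δ δ>0
    in (P ℕ.⊔ Q) ℕ.⊔ (M ℕ.⊔ N) , λ m n ≤m ≤n →
      let PQ≤m = ℕ.m⊔n≤o⇒m≤o (P ℕ.⊔ Q) (M ℕ.⊔ N) ≤m
          PQ≤n = ℕ.m⊔n≤o⇒m≤o (P ℕ.⊔ Q) (M ℕ.⊔ N) ≤n
          MN≤m = ℕ.m⊔n≤o⇒n≤o (P ℕ.⊔ Q) (M ℕ.⊔ N) ≤m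
          MN≤n = ℕ.m⊔n≤o⇒n≤o (P ℕ.⊔ Q) (M ℕ.⊔ N) ≤n
      in *-close (x m) (y m) (x n) (y n) ε
           (smallʸ (x m) (y m ℚ.- y n)
             (boundˣ m (ℕ.m⊔n≤o⇒m≤o P Q PQ≤m))
             (closeʸ m n (ℕ.m⊔n≤o⇒n≤o M N MN≤m) (ℕ.m⊔n≤o⇒n≤o M N MN≤n)))
           (smallˣ (y n) (x m ℚ.- x n)
             (boundʸ n (ℕ.m⊔n≤o⇒n≤o P Q PQ≤n))
             (closeˣ m n (ℕ.m⊔n≤o⇒m≤o M N MN≤m) (ℕ.m⊔n≤o⇒m≤o M N MN≤n)))

infixl 6 _+_
infixl 7 _*_
infix  8 -_

fromℚ : ℚ → ℝ
fromℚ q = mkℝ (λ _ → q) (const-cauchy q)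

0ℝ 1ℝ : ℝ
0ℝ = fromℚ 0ℚ
1ℝ = fromℚ 1ℚ

_+_ _*_ : ℝ → ℝ → ℝ
x + y = mkℝ (λ n → seq x n ℚ.+ seq y n) (+-cauchy (seq x) (seq y) (cauchy x) (cauchy y))
x * y = mkℝ (λ n → seq x n ℚ.* seq y n) (*-cauchy (seq x) (seq y) (cauchy x) (cauchy y))

-_ : ℝ → ℝ
- x = mkℝ (λ n → ℚ.- seq x n) (neg-cauchy (seq x) (cauchy x))

ℝ-rawRing : RawRing 0ℓ 0ℓ
ℝ-rawRing = record
  { Carrier = ℝ ; _≈_ = _≈_ ; _+_ = _+_ ; _*_ = _*_ ; -_ = -_ ; 0# = 0ℝ ; 1# = 1ℝ }

module ℝᵈ = SemiringDefinitions (RawRing.rawSemiring ℝ-rawRing)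

-- ℝ[x₁,…,xₙ]: finite formal sums of terms c · x^α, two of them being
-- equal when all their coefficients agree.

Monomial : ℕ → Set
Monomial n = Vec ℕ n

Poly : ℕ → Set
Poly n = List (ℝ × Monomial n)

coeff : ∀ {n} → Poly n → Monomial n → ℝ
coeff []            β = 0ℝ
coeff ((c , α) ∷ p) β with Vec.≡-dec ℕ._≟_ α β
... | yes _ = c + coeff p β
... | no  _ = coeff p β

infix 4 _≈ₚ_

_≈ₚ_ : ∀ {n} → Poly n → Poly n → Set
p ≈ₚ q = ∀ α → coeff p α ≈ coeff q α

infixl 6 _+ₚ_ _-ₚ_
infixl 7 _*ₚ_
infix  8 -ₚ_

con : ∀ {n} → ℝ → Poly n
con {n} c = (c , replicate n 0) ∷ []

0ₚ 1ₚ : ∀ {n} → Poly n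
0ₚ = []
1ₚ = con 1ℝ

_+ₚ_ _*ₚ_ : ∀ {n} → Poly n → Poly n → Poly n
p +ₚ q = p ++ q
p *ₚ q = cartesianProductWith (λ (c , α) (d , β) → c * d , zipWith ℕ._+_ α β) p q

-ₚ_ : ∀ {n} → Poly n → Poly n
-ₚ p = map (map₁ -_) p

_-ₚ_ : ∀ {n} → Poly n → Poly n → Poly n
p -ₚ q = p +ₚ -ₚ q

Poly-rawRing : ℕ → RawRing 0ℓ 0ℓ
Poly-rawRing n = record
  { Carrier = Poly n ; _≈_ = _≈ₚ_ ; _+_ = _+ₚ_ ; _*_ = _*ₚ_ ; -_ = -ₚ_ ; 0# = 0ₚ ; 1# = 1ₚ }

sumₚ : ∀ {n m} → Vector (Poly n) m → Poly n
sumₚ {n} = SemiringDefinitions.sum (RawRing.rawSemiring (Poly-rawRing n))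

evalMonomial : ∀ {n} → Monomial n → Vector ℝ n → ℝ
evalMonomial α x = ℝᵈ.product λ k → x k ℝᵈ.^ lookup α k

eval : ∀ {n} → Poly n → Vector ℝ n → ℝ
eval p x = List.foldr (λ (c , α) s → c * evalMonomial α x + s) 0ℝ p

-- If lookup α k is 0, the truncated exponent is harmless: the
-- coefficient vanishes.
∂ : ∀ {n} → Fin n → Poly n → Poly n
∂ k = map λ (c , α) → lookup α k ℝᵈ.× c , α [ k ]%= ℕ.pred

∇ : ∀ {n} → Poly n → Vector (Poly n) n
∇ p k = ∂ k p

⟨_,_⟩ : ∀ {n m} → Vector (Poly n) m → Vector (Poly n) m → Poly n
⟨ g , h ⟩ = sumₚ λ k → g k *ₚ h k

IsSOS : ∀ {n} → Poly n → Set
IsSOS {n} p = ∃ λ m → Σ (Vector (Poly n) m) λ g → p ≈ₚ sumₚ (λ k → g k *ₚ g k)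

infix 4 _∈Ideal_

_∈Ideal_ : ∀ {n m} → Poly n → Vector (Poly n) m → Set
_∈Ideal_ {n} {m} p g = Σ (Vector (Poly n) m) λ h → p ≈ₚ ⟨ h , g ⟩

ℒ : ∀ {n} → Vector (Poly n) n → ℕ → Poly n → Poly n
ℒ f zero    B = B
ℒ f (suc k) B = ⟨ ∇ (ℒ f k B) , f ⟩

NextInIdeal : ∀ {n} → Vector (Poly n) n → Poly n → ℕ → Set
NextInIdeal f B i = ℒ f (suc i) B ∈Ideal λ (j : Fin (suc i)) → ℒ f (toℕ j) B

record IsCompletenessThreshold {n} (f : Vector (Poly n) n) (B : Poly n) (N : ℕ) : Set where
  field
    positive : 1 ℕ.≤ N
    inIdeal  : NextInIdeal f B N
    minimal  : ∀ i → 1 ℕ.≤ i → NextInIdeal f B i → N ℕ.≤ i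

-- The threshold exists by Hilbert's basis theorem, which is not
-- available constructively, so it is supplied as data.
CompletenessThreshold : ∀ {n} → Vector (Poly n) n → Poly n → Set
CompletenessThreshold f B = ∃ (IsCompletenessThreshold f B)

record IsInvariantBarrierCertificate {n} (f : Vector (Poly n) n) (B : Poly n)
  (N : CompletenessThreshold f B) (X₀ Xᵤ : Pred (Vector ℝ n) 0ℓ) : Set where
  field
    initial     : ∀ x → X₀ x → eval B x ≤ 0ℝ
    consecution : ∀ x i → 1 ℕ.≤ i → i ℕ.≤ proj₁ N →
                  (∀ j → j ℕ.< i → eval (ℒ f j B) x ≈ 0ℝ) →
                  eval (ℒ f i B) x ≤ 0ℝ
    separation  : ∀ x → Xᵤ x → 0ℝ < eval B x

{-# OPTIONS --safe #-}
module Submission where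

-- Evaluating a certificate identity at x turns each SOS polynomial into a sum
-- of squares of reals.  A square times a nonpositive real is nonpositive, so
-- the σ I and σ′ U terms have the right sign on X₀ and Xᵤ, and the terms
-- v i j · ℒʲ B vanish under the hypothesis of consecution.  As SOS is defined
-- by equality of coefficients, evaluation must be shown to depend on nothing
-- else: both polynomials are expanded over one common duplicate-free list of
-- monomials.

open import Algebra.Bundles using (CommutativeRing)
import Algebra.Properties.CommutativeSemigroup as CommutativeSemigroupProperties
import Algebra.Properties.Ring as RingProperties
import Algebra.Properties.Semiring.Sum as Sum
open import Data.Fin.Base using (Fin; zero; suc; toℕ)
open import Data.Fin.Properties using (toℕ<n)
open import Data.List.Base using (List; []; _∷_; _++_; map; foldr; deduplicate)
open import Data.List.Membership.Propositional using (_∈_)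
open import Data.List.Membership.Propositional.Properties
  using (∈-++⁺ˡ; ∈-++⁺ʳ; ∈-deduplicate⁺)
open import Data.List.Relation.Unary.All as All using (All; []; _∷_)
open import Data.List.Relation.Unary.Any using (here; there)
open import Data.List.Relation.Unary.Unique.DecPropositional.Properties using (deduplicate-!)
open import Data.List.Relation.Unary.Unique.Propositional using (Unique; []; _∷_)
open import Data.Nat.Base as ℕ using (ℕ; zero; suc)
import Data.Nat.Properties as ℕ
open import Data.Product.Base using (∃; Σ; _,_; proj₁; proj₂)
open import Data.Rational.Base as ℚ using (0ℚ; ½)
import Data.Rational.Properties as ℚ
open import Data.Rational.Solver using (module +-*-Solver)
open import Data.Sum.Base using (inj₁; inj₂)
open import Data.Vec.Base using ([]; _∷_; replicate; zipWith)
open import Data.Vec.Functional using (Vector; tail)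
import Data.Vec.Properties as Vec
open import Function.Base using (_∘_)
open import Level using (0ℓ)
open import Relation.Binary.Bundles using (Preorder)
import Relation.Binary.Reasoning.Preorder as PreorderReasoning
import Relation.Binary.Reasoning.Setoid as SetoidReasoning
open import Relation.Binary.PropositionalEquality as ≡ using (_≡_; _≢_)
open import Relation.Nullary using (yes; no; contradiction)
open import Relation.Unary using (Pred)

open import Defs

-- Rational inequalities

p≤∣p∣ : ∀ p → p ℚ.≤ ℚ.∣ p ∣
p≤∣p∣ p with ℚ.≤-total 0ℚ p
... | inj₁ 0≤p = ℚ.≤-reflexive (≡.sym (ℚ.0≤p⇒∣p∣≡p 0≤p))
... | inj₂ p≤0 = ℚ.≤-trans p≤0 (ℚ.0≤∣p∣ p)

0≤p*p : ∀ p → 0ℚ ℚ.≤ p ℚ.* p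
0≤p*p p with ℚ.≤-total 0ℚ p
... | inj₁ 0≤p = ℚ.nonNegative⁻¹ (p ℚ.* p) {{ℚ.nonNeg*nonNeg⇒nonNeg p p}}
  where instance _ = ℚ.nonNegative 0≤p
... | inj₂ p≤0 = ℚ.nonNegative⁻¹ (p ℚ.* p) {{ℚ.nonPos*nonPos⇒nonPos p p}}
  where instance _ = ℚ.nonPositive p≤0

+-cancelʳ-≤ : ∀ r p q → p ℚ.+ r ℚ.≤ q ℚ.+ r → p ℚ.≤ q
+-cancelʳ-≤ r p q p+r≤q+r = begin
  p                    ≡⟨ [p+r]-r≡p p r ⟨
  p ℚ.+ r ℚ.- r        ≤⟨ ℚ.+-monoˡ-≤ (ℚ.- r) p+r≤q+r ⟩
  q ℚ.+ r ℚ.- r        ≡⟨ [p+r]-r≡p q r ⟩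
  q                    ∎
  where
  open ℚ.≤-Reasoning
  [p+r]-r≡p : ∀ p r → p ℚ.+ r ℚ.- r ≡ p
  [p+r]-r≡p = solve 2 (λ p r → p :+ r :- r := p) ≡.refl
    where open +-*-Solver

∣p-q∣≤ε⇒p≤q+ε : ∀ p q {ε} → ℚ.∣ p ℚ.- q ∣ ℚ.≤ ε → p ℚ.≤ q ℚ.+ ε
∣p-q∣≤ε⇒p≤q+ε p q {ε} p~q = begin
  p                       ≡⟨ m≡n+[m-n] p q ⟩
  q ℚ.+ (p ℚ.- q)         ≤⟨ ℚ.+-monoʳ-≤ q (ℚ.≤-trans (p≤∣p∣ (p ℚ.- q)) p~q) ⟩
  q ℚ.+ ε                 ∎
  where open ℚ.≤-Reasoning

-- Properties of all large indices

eventually-map : ∀ {P Q : Pred ℕ 0ℓ} → (∀ n → P n → Q n) → Eventually P → Eventually Q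
eventually-map f (N , p) = N , λ n N≤n → f n (p n N≤n)

eventually-zip : ∀ {P Q R : Pred ℕ 0ℓ} → (∀ n → P n → Q n → R n) →
  Eventually P → Eventually Q → Eventually R
eventually-zip f (M , p) (N , q) = M ℕ.⊔ N , λ n ≤n →
  f n (p n (ℕ.m⊔n≤o⇒m≤o M N ≤n)) (q n (ℕ.m⊔n≤o⇒n≤o M N ≤n))

-- The reals as a commutative ring

infix 4 _≃_

-- Agda cannot recover x and y from the unfolding of x ≈ y, which only
-- mentions their sequences; the record makes them inferable.
record _≃_ (x y : ℝ) : Set where
  constructor mk≃
  field unwrap : x ≈ y

open _≃_

-- Operations on reals act termwise on sequences, so every ring law of the rationals passes to the
-- reals through this lemma, with no tolerance to estimate.
≗⇒≃ : ∀ {x y} → (∀ n → seq x n ≡ seq y n) → x ≃ y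
≗⇒≃ {x} {y} eq = mk≃ λ ε ε>0 → 0 , λ n _ → ≡.subst (ℚ._≤ ε)
  (≡.sym (≡.cong ℚ.∣_∣ (≡.trans (≡.cong (ℚ._- seq y n) (eq n)) (ℚ.+-inverseʳ (seq y n)))))
  (ℚ.<⇒≤ ε>0)

∣p-q∣≡∣q-p∣ : ∀ p q → ℚ.∣ p ℚ.- q ∣ ≡ ℚ.∣ q ℚ.- p ∣
∣p-q∣≡∣q-p∣ p q = ≡.trans (≡.sym (ℚ.∣-p∣≡∣p∣ (p ℚ.- q))) (≡.cong ℚ.∣_∣ (-[p-q]≡q-p p q))
  where
  -[p-q]≡q-p : ∀ p q → ℚ.- (p ℚ.- q) ≡ q ℚ.- p
  -[p-q]≡q-p = solve 2 (λ p q → :- (p :- q) := q :- p) ≡.refl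
    where open +-*-Solver

≃-sym : ∀ {x y} → x ≃ y → y ≃ x
≃-sym {x} {y} (mk≃ x≈y) = mk≃ λ ε ε>0 → eventually-map
  (λ n → ≡.subst (ℚ._≤ ε) (∣p-q∣≡∣q-p∣ (seq x n) (seq y n))) (x≈y ε ε>0)

≃-trans : ∀ {x y z} → x ≃ y → y ≃ z → x ≃ z
≃-trans {x} {y} {z} (mk≃ x≈y) (mk≃ y≈z) = mk≃ λ ε ε>0 → eventually-zip
  (λ n x~y y~z → ≡.subst (λ p → ℚ.∣ p ∣ ℚ.≤ ε) (cancel (seq x n) (seq y n) (seq z n))
    (ℚ.≤-trans (ℚ.∣p+q∣≤∣p∣+∣q∣ (seq x n ℚ.- seq y n) (seq y n ℚ.- seq z n))
      (ℚ.≤-trans (ℚ.+-mono-≤ x~y y~z) (ℚ.≤-reflexive (½+½ ε)))))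
  (x≈y (½ ℚ.* ε) (½-pos ε ε>0)) (y≈z (½ ℚ.* ε) (½-pos ε ε>0))
  where
  cancel : ∀ p q r → (p ℚ.- q) ℚ.+ (q ℚ.- r) ≡ p ℚ.- r
  cancel = solve 3 (λ p q r → (p :- q) :+ (q :- r) := p :- r) ≡.refl
    where open +-*-Solver

+-cong : ∀ {x y u v} → x ≃ y → u ≃ v → x + u ≃ y + v
+-cong {x} {y} {u} {v} (mk≃ x≈y) (mk≃ u≈v) = mk≃ λ ε ε>0 → eventually-zip
  (λ n → +-close (seq x n) (seq u n) (seq y n) (seq v n) ε)
  (x≈y (½ ℚ.* ε) (½-pos ε ε>0)) (u≈v (½ ℚ.* ε) (½-pos ε ε>0))

-‿cong : ∀ {x y} → x ≃ y → - x ≃ - y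
-‿cong {x} {y} (mk≃ x≈y) = mk≃ λ ε ε>0 → eventually-map
  (λ n → ≡.subst (ℚ._≤ ε) (≡.sym (≡.trans
    (≡.cong ℚ.∣_∣ (neg-split (seq x n) (seq y n))) (ℚ.∣-p∣≡∣p∣ (seq x n ℚ.- seq y n)))))
  (x≈y ε ε>0)

-- The difference `x * u - y * v` equals `x * (u - v) + v * (x - y)`. Cauchy sequences are
-- eventually bounded, so each summand can be kept within `½ ℚ.* ε`; only `x` and `v` have to be
-- bounded for this.
*-cong : ∀ {x y u v} → x ≃ y → u ≃ v → x * u ≃ y * v
*-cong {x} {y} {u} {v} (mk≃ x≈y) (mk≃ u≈v) = mk≃ λ ε ε>0 →
  let K , K>0 , boundˣ   = eventuallyBounded (seq x) (cauchy x)
      L , L>0 , boundᵛ   = eventuallyBounded (seq v) (cauchy v)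
      δ , δ>0 , smallᵘ   = scale K (½ ℚ.* ε) K>0 (½-pos ε ε>0)
      δ′ , δ′>0 , smallˣ = scale L (½ ℚ.* ε) L>0 (½-pos ε ε>0)
  in eventually-zip
    (λ n → *-close (seq x n) (seq u n) (seq y n) (seq v n) ε)
    (eventually-zip (λ n → smallᵘ (seq x n) (seq u n ℚ.- seq v n)) boundˣ (u≈v δ δ>0))
    (eventually-zip (λ n → smallˣ (seq v n) (seq x n ℚ.- seq y n)) boundᵛ (x≈y δ′ δ′>0))

ℝ-commutativeRing : CommutativeRing 0ℓ 0ℓ
ℝ-commutativeRing = record
  { Carrier = ℝ ; _≈_ = _≃_ ; _+_ = _+_ ; _*_ = _*_ ; -_ = -_ ; 0# = 0ℝ ; 1# = 1ℝ
  ; isCommutativeRing = record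
    { isRing = record
      { +-isAbelianGroup = record
        { isGroup = record
          { isMonoid = record
            { isSemigroup = record
              { isMagma = record
                { isEquivalence = record
                  { refl = ≗⇒≃ λ _ → ≡.refl ; sym = ≃-sym ; trans = ≃-trans }
                ; ∙-cong = +-cong
                }
              ; assoc = λ x y z → ≗⇒≃ λ n → ℚ.+-assoc (seq x n) (seq y n) (seq z n)
              }
            ; identity = (λ x → ≗⇒≃ λ n → ℚ.+-identityˡ (seq x n))
                       , (λ x → ≗⇒≃ λ n → ℚ.+-identityʳ (seq x n))
            }
          ; inverse = (λ x → ≗⇒≃ λ n → ℚ.+-inverseˡ (seq x n))
                    , (λ x → ≗⇒≃ λ n → ℚ.+-inverseʳ (seq x n))
          ; ⁻¹-cong = -‿cong
          }
        ; comm = λ x y → ≗⇒≃ λ n → ℚ.+-comm (seq x n) (seq y n)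
        }
      ; *-cong = *-cong
      ; *-assoc = λ x y z → ≗⇒≃ λ n → ℚ.*-assoc (seq x n) (seq y n) (seq z n)
      ; *-identity = (λ x → ≗⇒≃ λ n → ℚ.*-identityˡ (seq x n))
                   , (λ x → ≗⇒≃ λ n → ℚ.*-identityʳ (seq x n))
      ; distrib = (λ x y z → ≗⇒≃ λ n → ℚ.*-distribˡ-+ (seq x n) (seq y n) (seq z n))
                , (λ x y z → ≗⇒≃ λ n → ℚ.*-distribʳ-+ (seq x n) (seq y n) (seq z n))
      }
    ; *-comm = λ x y → ≗⇒≃ λ n → ℚ.*-comm (seq x n) (seq y n)
    }
  }

open CommutativeRing ℝ-commutativeRing
  using ( setoid; isEquivalence; semiring; ring; +-commutativeSemigroup; *-commutativeSemigroup
        ; +-assoc; +-comm; +-identityˡ; +-identityʳ; +-congˡ; +-congʳ; -‿inverseʳ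
        ; *-congˡ; *-congʳ; *-assoc; *-identityˡ; *-identityʳ; distribˡ; distribʳ; zeroˡ; zeroʳ )
  renaming (refl to ≃-refl; reflexive to ≃-reflexive)
open CommutativeSemigroupProperties +-commutativeSemigroup using (x∙yz≈y∙xz)
open CommutativeSemigroupProperties *-commutativeSemigroup using (interchange)
open RingProperties ring using (-0#≈0#; -‿distribˡ-*; -‿+-comm)
open Sum semiring using (sum; sum-cong-≋; sum-replicate-zero; *-distribʳ-sum)

module ≃-Reasoning = SetoidReasoning setoid

-- The order on the reals

≃⇒≤ : ∀ {x y} → x ≃ y → x ≤ y
≃⇒≤ {x} {y} (mk≃ x≈y) ε ε>0 =
  eventually-map (λ n → ∣p-q∣≤ε⇒p≤q+ε (seq x n) (seq y n)) (x≈y ε ε>0)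

≤-trans : ∀ x y z → x ≤ y → y ≤ z → x ≤ z
≤-trans x y z x≤y y≤z ε ε>0 = eventually-zip
  (λ n xₙ≤ yₙ≤ → begin
    seq x n                                    ≤⟨ xₙ≤ ⟩
    seq y n ℚ.+ ½ ℚ.* ε                        ≤⟨ ℚ.+-monoˡ-≤ (½ ℚ.* ε) yₙ≤ ⟩
    seq z n ℚ.+ ½ ℚ.* ε ℚ.+ ½ ℚ.* ε            ≡⟨ ℚ.+-assoc (seq z n) (½ ℚ.* ε) (½ ℚ.* ε) ⟩
    seq z n ℚ.+ (½ ℚ.* ε ℚ.+ ½ ℚ.* ε)          ≡⟨ ≡.cong (seq z n ℚ.+_) (½+½ ε) ⟩
    seq z n ℚ.+ ε                              ∎)
  (x≤y (½ ℚ.* ε) (½-pos ε ε>0)) (y≤z (½ ℚ.* ε) (½-pos ε ε>0))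
  where open ℚ.≤-Reasoning

≤-preorder : Preorder 0ℓ 0ℓ 0ℓ
≤-preorder = record
  { Carrier = ℝ ; _≈_ = _≃_ ; _≲_ = _≤_
  ; isPreorder = record
    { isEquivalence = isEquivalence
    ; reflexive     = ≃⇒≤
    ; trans         = λ {x} {y} {z} → ≤-trans x y z
    }
  }

module ≤-Reasoning = PreorderReasoning ≤-preorder

+-interchangeℚ : ∀ p q r s → (p ℚ.+ q) ℚ.+ (r ℚ.+ s) ≡ (p ℚ.+ r) ℚ.+ (q ℚ.+ s)
+-interchangeℚ = solve 4 (λ p q r s → (p :+ q) :+ (r :+ s) := (p :+ r) :+ (q :+ s)) ≡.refl
  where open +-*-Solver

+-mono-≤ : ∀ x y u v → x ≤ y → u ≤ v → x + u ≤ y + v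
+-mono-≤ x y u v x≤y u≤v ε ε>0 = eventually-zip
  (λ n xₙ≤ uₙ≤ → begin
    seq x n ℚ.+ seq u n
      ≤⟨ ℚ.+-mono-≤ xₙ≤ uₙ≤ ⟩
    (seq y n ℚ.+ ½ ℚ.* ε) ℚ.+ (seq v n ℚ.+ ½ ℚ.* ε)
      ≡⟨ +-interchangeℚ (seq y n) (½ ℚ.* ε) (seq v n) (½ ℚ.* ε) ⟩
    (seq y n ℚ.+ seq v n) ℚ.+ (½ ℚ.* ε ℚ.+ ½ ℚ.* ε)
      ≡⟨ ≡.cong (seq y n ℚ.+ seq v n ℚ.+_) (½+½ ε) ⟩
    (seq y n ℚ.+ seq v n) ℚ.+ ε
      ∎)
  (x≤y (½ ℚ.* ε) (½-pos ε ε>0)) (u≤v (½ ℚ.* ε) (½-pos ε ε>0))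
  where open ℚ.≤-Reasoning

+-monoʳ-≤ : ∀ x y z → y ≤ z → x + y ≤ x + z
+-monoʳ-≤ x y z y≤z = +-mono-≤ x x y z (≃⇒≤ (≃-refl {x})) y≤z

-- A strict inequality carries a fixed rational gap `ε`, while `y ≤ z` allows any positive slack.
-- Spending half of the gap on the slack leaves the other half as the new gap.
<-≤-trans : ∀ x y z → x < y → y ≤ z → x < z
<-≤-trans x y z (ε , ε>0 , x<y) y≤z = ½ ℚ.* ε , ½-pos ε ε>0 , eventually-zip
  (λ n xₙ≤ yₙ≤ → +-cancelʳ-≤ (½ ℚ.* ε) (seq x n ℚ.+ ½ ℚ.* ε) (seq z n) (begin
    seq x n ℚ.+ ½ ℚ.* ε ℚ.+ ½ ℚ.* ε          ≡⟨ ℚ.+-assoc (seq x n) (½ ℚ.* ε) (½ ℚ.* ε) ⟩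
    seq x n ℚ.+ (½ ℚ.* ε ℚ.+ ½ ℚ.* ε)        ≡⟨ ≡.cong (seq x n ℚ.+_) (½+½ ε) ⟩
    seq x n ℚ.+ ε                            ≤⟨ xₙ≤ ⟩
    seq y n                                  ≤⟨ yₙ≤ ⟩
    seq z n ℚ.+ ½ ℚ.* ε                      ∎))
  x<y (y≤z (½ ℚ.* ε) (½-pos ε ε>0))
  where open ℚ.≤-Reasoning

0≤x*x : ∀ x → 0ℝ ≤ x * x
-- The left-hand side `0ℚ ℚ.+ 0ℚ` produced by monotonicity computes to `0ℚ`, and the bound holds
-- from index 0 on.
0≤x*x x ε ε>0 = 0 , λ n _ → ℚ.+-mono-≤ (0≤p*p (seq x n)) (ℚ.<⇒≤ ε>0)

-- The factor is a square because its terms are then nonnegative exactly, not just up to a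
-- tolerance. Only the slack of `y` remains, and it is multiplied by an eventually bounded quantity.
x*x*y≤0 : ∀ x y → y ≤ 0ℝ → x * x * y ≤ 0ℝ
x*x*y≤0 x y y≤0 ε ε>0 =
  let K , K>0 , bound = eventuallyBounded (seq (x * x)) (cauchy (x * x))
      -- The slack granted to `y` is small enough that a factor of size at most `K` cannot raise it
      -- above `ε`.
      δ , δ>0 , small = scale K ε K>0 ε>0
  in eventually-zip
    (λ n xₙ²≤K yₙ≤δ → let p = seq x n ℚ.* seq x n in begin
      p ℚ.* seq y n           ≤⟨ ℚ.*-monoˡ-≤-nonNeg p {{ℚ.nonNegative (0≤p*p (seq x n))}} yₙ≤δ ⟩
      p ℚ.* (0ℚ ℚ.+ δ)        ≡⟨ ≡.cong (p ℚ.*_) (ℚ.+-identityˡ δ) ⟩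
      p ℚ.* δ                 ≤⟨ p≤∣p∣ (p ℚ.* δ) ⟩
      ℚ.∣ p ℚ.* δ ∣           ≤⟨ small p δ xₙ²≤K (ℚ.≤-reflexive (ℚ.0≤p⇒∣p∣≡p (ℚ.<⇒≤ δ>0))) ⟩
      ε                       ≡⟨ ℚ.+-identityˡ ε ⟨
      0ℚ ℚ.+ ε                ∎)
    bound (y≤0 δ δ>0)
  where open ℚ.≤-Reasoning

sum-mono-≤ : ∀ {m} (f g : Vector ℝ m) → (∀ k → f k ≤ g k) → sum f ≤ sum g
sum-mono-≤ {zero}  f g f≤g = ≃⇒≤ (≃-refl {0ℝ})
sum-mono-≤ {suc m} f g f≤g = +-mono-≤ (f zero) (g zero) (sum (tail f)) (sum (tail g))
  (f≤g zero) (sum-mono-≤ (tail f) (tail g) (f≤g ∘ suc))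

0≤-y+z⇒y≤z : ∀ y z → 0ℝ ≤ - y + z → y ≤ z
0≤-y+z⇒y≤z y z 0≤-y+z = begin
  y                  ≈⟨ +-identityʳ y ⟨
  y + 0ℝ             ≲⟨ +-monoʳ-≤ y 0ℝ (- y + z) 0≤-y+z ⟩
  y + (- y + z)      ≈⟨ +-assoc y (- y) z ⟨
  y + - y + z        ≈⟨ +-congʳ (-‿inverseʳ y) ⟩
  0ℝ + z             ≈⟨ +-identityˡ z ⟩
  z                  ∎
  where open ≤-Reasoning

-- Evaluation is a ring homomorphism

module _ {n : ℕ} (x : Vector ℝ n) where

  eval-++ : ∀ p q → eval (p ++ q) x ≃ eval p x + eval q x
  eval-++ []            q = ≃-sym (+-identityˡ (eval q x))
  eval-++ ((c , α) ∷ p) q =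
    ≃-trans (+-congˡ (eval-++ p q)) (≃-sym (+-assoc (c * evalMonomial α x) (eval p x) (eval q x)))

  eval-neg : ∀ p → eval (-ₚ p) x ≃ - eval p x
  eval-neg []            = ≃-sym -0#≈0#
  eval-neg ((c , α) ∷ p) = begin
    - c * evalMonomial α x + eval (-ₚ p) x      ≈⟨ +-cong (≃-sym (-‿distribˡ-* c (evalMonomial α x))) (eval-neg p) ⟩
    - (c * evalMonomial α x) + - eval p x       ≈⟨ -‿+-comm (c * evalMonomial α x) (eval p x) ⟩
    - (c * evalMonomial α x + eval p x)         ∎
    where open ≃-Reasoning

-- The stdlib lemma of this name is about powers in a semiring whose equality
-- is _≃_, which are not definitionally the powers ℝᵈ._^_ of ℝ-rawRing.
^-homo-* : ∀ x a b → x ℝᵈ.^ (a ℕ.+ b) ≃ x ℝᵈ.^ a * x ℝᵈ.^ b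
^-homo-* x zero    b = ≃-sym (*-identityˡ (x ℝᵈ.^ b))
^-homo-* x (suc a) b = ≃-trans (*-congˡ (^-homo-* x a b)) (≃-sym (*-assoc x (x ℝᵈ.^ a) (x ℝᵈ.^ b)))

evalMonomial-0 : ∀ {n} (x : Vector ℝ n) → evalMonomial (replicate n 0) x ≃ 1ℝ
evalMonomial-0 {zero}  x = ≃-refl
evalMonomial-0 {suc n} x = ≃-trans (*-identityˡ (evalMonomial (replicate n 0) (tail x))) (evalMonomial-0 (tail x))

evalMonomial-+ : ∀ {n} (α β : Monomial n) (x : Vector ℝ n) →
  evalMonomial (zipWith ℕ._+_ α β) x ≃ evalMonomial α x * evalMonomial β x
evalMonomial-+ []      []      x = ≃-sym (*-identityˡ 1ℝ)
evalMonomial-+ (a ∷ α) (b ∷ β) x = begin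
  x zero ^ (a ℕ.+ b) * evalMonomial (zipWith ℕ._+_ α β) (tail x)
    ≈⟨ *-cong (^-homo-* (x zero) a b) (evalMonomial-+ α β (tail x)) ⟩
  (x zero ^ a * x zero ^ b) * (evalMonomial α (tail x) * evalMonomial β (tail x))
    ≈⟨ interchange (x zero ^ a) (x zero ^ b) (evalMonomial α (tail x)) (evalMonomial β (tail x)) ⟩
  (x zero ^ a * evalMonomial α (tail x)) * (x zero ^ b * evalMonomial β (tail x))
    ∎
  where
  open ≃-Reasoning
  open ℝᵈ using (_^_)

module _ {n : ℕ} (x : Vector ℝ n) where

  eval-con : ∀ c → eval (con c) x ≃ c
  eval-con c = begin
    c * evalMonomial (replicate n 0) x + 0ℝ      ≈⟨ +-identityʳ _ ⟩
    c * evalMonomial (replicate n 0) x           ≈⟨ *-congˡ (evalMonomial-0 x) ⟩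
    c * 1ℝ                                       ≈⟨ *-identityʳ c ⟩
    c                                            ∎
    where open ≃-Reasoning

  -- The mapped list is the contribution of one term of the left factor to `_*ₚ_`, so this is the
  -- inductive step of `eval-*`.
  eval-term-* : ∀ c α q →
    eval (map (λ (d , β) → c * d , zipWith ℕ._+_ α β) q) x ≃ c * evalMonomial α x * eval q x
  eval-term-* c α []            = ≃-sym (zeroʳ (c * evalMonomial α x))
  eval-term-* c α ((d , β) ∷ q) = begin
    c * d * evalMonomial (zipWith ℕ._+_ α β) x + _
      ≈⟨ +-cong (*-congˡ (evalMonomial-+ α β x)) (eval-term-* c α q) ⟩
    c * d * (evalMonomial α x * evalMonomial β x) + c * evalMonomial α x * eval q x
      ≈⟨ +-congʳ (interchange c d (evalMonomial α x) (evalMonomial β x)) ⟩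
    c * evalMonomial α x * (d * evalMonomial β x) + c * evalMonomial α x * eval q x
      ≈⟨ distribˡ (c * evalMonomial α x) (d * evalMonomial β x) (eval q x) ⟨
    c * evalMonomial α x * (d * evalMonomial β x + eval q x)
      ∎
    where open ≃-Reasoning

  eval-* : ∀ p q → eval (p *ₚ q) x ≃ eval p x * eval q x
  eval-* []            q = ≃-sym (zeroˡ (eval q x))
  eval-* ((c , α) ∷ p) q = begin
    eval (((c , α) ∷ p) *ₚ q) x
      ≈⟨ eval-++ x (map (λ (d , β) → c * d , zipWith ℕ._+_ α β) q) (p *ₚ q) ⟩
    eval (map (λ (d , β) → c * d , zipWith ℕ._+_ α β) q) x + eval (p *ₚ q) x
      ≈⟨ +-cong (eval-term-* c α q) (eval-* p q) ⟩
    c * evalMonomial α x * eval q x + eval p x * eval q x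
      ≈⟨ distribʳ (eval q x) (c * evalMonomial α x) (eval p x) ⟨
    (c * evalMonomial α x + eval p x) * eval q x
      ∎
    where open ≃-Reasoning

  -- Used both for sums of squares, as `⟨ g , g ⟩`, and for the combinations of Lie derivatives in
  -- the consecution condition.
  eval-⟨⟩ : ∀ {m} (g h : Vector (Poly n) m) →
    eval ⟨ g , h ⟩ x ≃ sum λ k → eval (g k) x * eval (h k) x
  eval-⟨⟩ {zero}  g h = ≃-refl
  eval-⟨⟩ {suc m} g h = ≃-trans (eval-++ x (g zero *ₚ h zero) ⟨ tail g , tail h ⟩)
    (+-cong (eval-* (g zero) (h zero)) (eval-⟨⟩ (tail g) (tail h)))

-- Evaluation respects equality of coefficients

coeff-here : ∀ {n} c (α : Monomial n) p → coeff ((c , α) ∷ p) α ≡ c + coeff p α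
coeff-here c α p with Vec.≡-dec ℕ._≟_ α α
... | yes _  = ≡.refl
... | no α≢α = contradiction ≡.refl α≢α

coeff-there : ∀ {n} c {α β : Monomial n} p → α ≢ β → coeff ((c , α) ∷ p) β ≡ coeff p β
coeff-there c {α} {β} p α≢β with Vec.≡-dec ℕ._≟_ α β
... | yes α≡β = contradiction α≡β α≢β
... | no _    = ≡.refl

module _ {n : ℕ} (x : Vector ℝ n) where

  -- Evaluation with like terms collected: `p` enters only through `coeff`, and the monomials come
  -- from a list chosen independently of `p`.
  evalOn : List (Monomial n) → Poly n → ℝ
  evalOn S p = foldr (λ β s → coeff p β * evalMonomial β x + s) 0ℝ S

  evalOn-[] : ∀ S → evalOn S [] ≃ 0ℝ
  evalOn-[] []      = ≃-refl
  evalOn-[] (β ∷ S) = ≃-trans (+-cong (zeroˡ (evalMonomial β x)) (evalOn-[] S)) (+-identityˡ 0ℝ)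

  evalOn-cong : ∀ S {p q} → p ≈ₚ q → evalOn S p ≃ evalOn S q
  evalOn-cong []      p≈q = ≃-refl
  evalOn-cong (β ∷ S) {p} {q} p≈q = +-cong (*-congʳ (mk≃ (p≈q β))) (evalOn-cong S {p} {q} p≈q)

  evalOn-∷-∉ : ∀ {S} c {α} p → All (α ≢_) S → evalOn S ((c , α) ∷ p) ≃ evalOn S p
  evalOn-∷-∉ c p []            = ≃-refl
  evalOn-∷-∉ c p (α≢β ∷ α∉S) =
    +-cong (*-congʳ (≃-reflexive (coeff-there c p α≢β))) (evalOn-∷-∉ c p α∉S)

  -- The list contains `α` exactly once, so the new coefficient is counted exactly once: entries
  -- after that occurrence, like those before it, differ from `α` and keep their coefficients.
  evalOn-∷-∈ : ∀ {S} c {α} p → Unique S → α ∈ S →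
    evalOn S ((c , α) ∷ p) ≃ c * evalMonomial α x + evalOn S p
  evalOn-∷-∈ {α ∷ S} c p (α∉S ∷ _) (here ≡.refl) = begin
    coeff ((c , α) ∷ p) α * evalMonomial α x + evalOn S ((c , α) ∷ p)
      ≈⟨ +-cong (*-congʳ (≃-reflexive (coeff-here c α p))) (evalOn-∷-∉ c p α∉S) ⟩
    (c + coeff p α) * evalMonomial α x + evalOn S p
      ≈⟨ +-congʳ (distribʳ (evalMonomial α x) c (coeff p α)) ⟩
    c * evalMonomial α x + coeff p α * evalMonomial α x + evalOn S p
      ≈⟨ +-assoc _ _ _ ⟩
    c * evalMonomial α x + (coeff p α * evalMonomial α x + evalOn S p)
      ∎
    where open ≃-Reasoning
  evalOn-∷-∈ {β ∷ S} c {α} p (β∉S ∷ S!) (there α∈S) = begin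
    coeff ((c , α) ∷ p) β * evalMonomial β x + evalOn S ((c , α) ∷ p)
      ≈⟨ +-cong (*-congʳ (≃-reflexive (coeff-there c p (All.lookup β∉S α∈S ∘ ≡.sym))))
                (evalOn-∷-∈ c p S! α∈S) ⟩
    coeff p β * evalMonomial β x + (c * evalMonomial α x + evalOn S p)
      ≈⟨ x∙yz≈y∙xz _ _ _ ⟩
    c * evalMonomial α x + (coeff p β * evalMonomial β x + evalOn S p)
      ∎
    where open ≃-Reasoning

  -- Monomials of `S` that do not occur in `p` have coefficient zero and contribute nothing. Hence
  -- mere inclusion suffices, and one list can serve two polynomials.
  eval≃evalOn : ∀ {S} → Unique S → ∀ p → (∀ {α} → α ∈ map proj₂ p → α ∈ S) → eval p x ≃ evalOn S p
  eval≃evalOn {S} S! []            p⊆S = ≃-sym (evalOn-[] S)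
  eval≃evalOn     S! ((c , α) ∷ p) p⊆S =
    ≃-trans (+-congˡ (eval≃evalOn S! p (p⊆S ∘ there))) (≃-sym (evalOn-∷-∈ c p S! (p⊆S (here ≡.refl))))

  eval-cong : ∀ {p q} → p ≈ₚ q → eval p x ≃ eval q x
  eval-cong {p} {q} p≈q = begin
    eval p x          ≈⟨ eval≃evalOn S! p (∈-deduplicate⁺ _≟_ ∘ ∈-++⁺ˡ) ⟩
    evalOn S p        ≈⟨ evalOn-cong S {p} {q} p≈q ⟩
    evalOn S q        ≈⟨ eval≃evalOn S! q (∈-deduplicate⁺ _≟_ ∘ ∈-++⁺ʳ (map proj₂ p)) ⟨
    eval q x          ∎
    where
    open ≃-Reasoning
    _≟_ = Vec.≡-dec ℕ._≟_
    S   = deduplicate _≟_ (map proj₂ p ++ map proj₂ q)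
    S!  = deduplicate-! _≟_ (map proj₂ p ++ map proj₂ q)

  -- Values of sum-of-squares polynomials

  eval-SOS : ∀ {p} → IsSOS p → ∃ λ m → Σ (Vector ℝ m) λ a → eval p x ≃ sum λ k → a k * a k
  eval-SOS {p} (m , g , p≈g²) =
    -- The sum of squares in `IsSOS` is by definition `⟨ g , g ⟩`.
    m , (λ k → eval (g k) x) , ≃-trans (eval-cong {p} {⟨ g , g ⟩} p≈g²) (eval-⟨⟩ x g g)

  SOS⇒0≤ : ∀ {p} → IsSOS p → 0ℝ ≤ eval p x
  SOS⇒0≤ {p} sos = let m , a , p≃a² = eval-SOS {p} sos in begin
    0ℝ                            ≈⟨ sum-replicate-zero m ⟨
    sum {m} (λ _ → 0ℝ)            ≲⟨ sum-mono-≤ (λ _ → 0ℝ) (λ k → a k * a k) (λ k → 0≤x*x (a k)) ⟩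
    sum (λ k → a k * a k)         ≈⟨ p≃a² ⟨
    eval p x                      ∎
    where open ≤-Reasoning

  -- Distributing `y` over the squares reduces the sign to that of a single square times `y`. This
  -- is why `eval-SOS` retains the squares themselves and not only the sign of their sum.
  SOS*≤0 : ∀ {p} → IsSOS p → ∀ y → y ≤ 0ℝ → eval p x * y ≤ 0ℝ
  SOS*≤0 {p} sos y y≤0 = let m , a , p≃a² = eval-SOS {p} sos in begin
    eval p x * y                      ≈⟨ *-congʳ p≃a² ⟩
    sum (λ k → a k * a k) * y         ≈⟨ *-distribʳ-sum y (λ k → a k * a k) ⟩
    sum (λ k → a k * a k * y)         ≲⟨ sum-mono-≤ (λ k → a k * a k * y) (λ _ → 0ℝ) (λ k → x*x*y≤0 (a k) y y≤0) ⟩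
    sum {m} (λ _ → 0ℝ)                ≈⟨ sum-replicate-zero m ⟩
    0ℝ                                ∎
    where open ≤-Reasoning

  -- The shape of the initial and consecution certificates, with `p` equal to `B` or to a Lie
  -- derivative.
  SOS-neg+⇒≤ : ∀ p q → IsSOS (-ₚ p +ₚ q) → eval p x ≤ eval q x
  SOS-neg+⇒≤ p q sos = 0≤-y+z⇒y≤z (eval p x) (eval q x) (begin
    0ℝ                            ≲⟨ SOS⇒0≤ { -ₚ p +ₚ q} sos ⟩
    eval (-ₚ p +ₚ q) x            ≈⟨ eval-++ x (-ₚ p) q ⟩
    eval (-ₚ p) x + eval q x      ≈⟨ +-congʳ (eval-neg x p) ⟩
    - eval p x + eval q x         ∎)
    where open ≤-Reasoning

  -- The shape of the separation certificate, with the constant polynomial `con ε` as `q`.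
  SOS-minus⇒≤ : ∀ p q → IsSOS (p -ₚ q) → eval q x ≤ eval p x
  SOS-minus⇒≤ p q sos = 0≤-y+z⇒y≤z (eval q x) (eval p x) (begin
    0ℝ                            ≲⟨ SOS⇒0≤ {p -ₚ q} sos ⟩
    eval (p -ₚ q) x               ≈⟨ eval-++ x p (-ₚ q) ⟩
    eval p x + eval (-ₚ q) x      ≈⟨ +-congˡ (eval-neg x q) ⟩
    eval p x + - eval q x         ≈⟨ +-comm (eval p x) (- eval q x) ⟩
    - eval q x + eval p x         ∎)
    where open ≤-Reasoning

-- From SOS certificates to the barrier conditions

theorem5 : ∀ (n : ℕ) (f : Vector (Poly n) n) (I U B : Poly n)
    (N : CompletenessThreshold f B)
    (ε : ℝ) (v : (i : ℕ) → Fin i → Poly n) (σ σ′ : Poly n) →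
    0ℝ < ε →
    IsSOS σ →
    IsSOS σ′ →
    IsSOS (-ₚ B +ₚ σ *ₚ I) →
    (∀ i → 1 ℕ.≤ i → i ℕ.≤ proj₁ N →
    IsSOS (-ₚ ℒ f i B +ₚ sumₚ (λ (j : Fin i) → v i j *ₚ ℒ f (toℕ j) B))) →
    IsSOS (B +ₚ σ′ *ₚ U -ₚ con ε) →
    IsInvariantBarrierCertificate f B N
    (λ x → eval I x ≤ 0ℝ) (λ x → eval U x ≤ 0ℝ)
theorem5 n f I U B N ε v σ σ′ 0<ε σ-sos σ′-sos initial-sos consecution-sos separation-sos = record
  { initial = λ x I≤0 → begin
      eval B x                 ≲⟨ SOS-neg+⇒≤ x B (σ *ₚ I) initial-sos ⟩
      eval (σ *ₚ I) x          ≈⟨ eval-* x σ I ⟩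
      eval σ x * eval I x      ≲⟨ SOS*≤0 x {σ} σ-sos (eval I x) I≤0 ⟩
      0ℝ                       ∎
  ; consecution = λ x i 1≤i i≤N vanish → begin
      eval (ℒ f i B) x
        -- The `sumₚ` of the certificate and this pairing unfold to the same polynomial.
        ≲⟨ SOS-neg+⇒≤ x (ℒ f i B) ⟨ v i , (λ j → ℒ f (toℕ j) B) ⟩ (consecution-sos i 1≤i i≤N) ⟩
      eval ⟨ v i , (λ j → ℒ f (toℕ j) B) ⟩ x
        ≈⟨ eval-⟨⟩ x (v i) (λ j → ℒ f (toℕ j) B) ⟩
      sum (λ j → eval (v i j) x * eval (ℒ f (toℕ j) B) x)
        -- An index `j` in `Fin i` satisfies `toℕ j < i`, so the hypothesis of consecution
        -- annihilates every summand.
        ≈⟨ sum-cong-≋ (λ j → ≃-trans (*-congˡ (mk≃ (vanish (toℕ j) (toℕ<n j)))) (zeroʳ (eval (v i j) x))) ⟩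
      sum {i} (λ _ → 0ℝ)
        ≈⟨ sum-replicate-zero i ⟩
      0ℝ
        ∎
  -- The number `ε` lies strictly above 0 and bounds `eval B x` from below: the `σ′` term is
  -- nonpositive here, so dropping it only increases the value.
  ; separation = λ x U≤0 → <-≤-trans 0ℝ ε (eval B x) 0<ε (begin
      ε                                     ≈⟨ eval-con x ε ⟨
      eval (con ε) x                        ≲⟨ SOS-minus⇒≤ x (B +ₚ σ′ *ₚ U) (con ε) separation-sos ⟩
      eval (B +ₚ σ′ *ₚ U) x                 ≈⟨ eval-++ x B (σ′ *ₚ U) ⟩
      eval B x + eval (σ′ *ₚ U) x           ≈⟨ +-congˡ (eval-* x σ′ U) ⟩
      eval B x + eval σ′ x * eval U x       ≲⟨ +-monoʳ-≤ (eval B x) (eval σ′ x * eval U x) 0ℝ (SOS*≤0 x {σ′} σ′-sos (eval U x) U≤0) ⟩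
      eval B x + 0ℝ                         ≈⟨ +-identityʳ (eval B x) ⟩
      eval B x                              ∎)
  }
  where open ≤-Reasoning
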